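{- Let $G$ be a group, $g,h,c\in G$, and $k=|G:C_G(h)|$, assumed finite. If the set $\{x\in G:[x,g,h]=c\}$ is $2k$-large in $G$, then $[a,g,h]=1$ for all $a\in G$. Similarly, if $c\in Z(G)$ and the set $\{x\in G:[g,x,h]=c\}$ is $2k$-large in $G$, then $[g,a,h]=1$ for all $a\in G$.
   Context: $[a,b]=a^{ -1}b^{ -1}ab$ and $[a,b,d]=[[a,b],d]$. A subset $X\subseteq G$ is $k$-large in $G$ if the intersection of any $k$ left translates $a_1X\cap\dots\cap a_kX$ ($a_i\in G$) is non-empty. -}

module Defs where

open import Algebra.Bundles using (Group)
open import Data.Fin.Base using (Fin)
open import Data.Nat.Base using (ℕ)
open import Data.Product.Base using (Σ-syntax; ∃-syntax; _×_)
open import Function.Definitions using (Bijective)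
open import Level using (Level; _⊔_)
open import Relation.Binary.Core using (Rel)
open import Relation.Binary.PropositionalEquality.Core using (_≡_)
open import Relation.Unary using (Pred; _∈_; Satisfiable; ⋂)

module GroupNotions {a ℓ : Level} (G : Group a ℓ) where

  open Group G

  private
    variable
      p : Level

  -- Triple commutators are left-normed: [a, b, d] is [ [ a , b ] , d ].
  [_,_] : Carrier → Carrier → Carrier
  [ x , y ] = x ⁻¹ ∙ y ⁻¹ ∙ x ∙ y

  Centralizer : Carrier → Pred Carrier ℓ
  Centralizer h x = x ∙ h ≈ h ∙ x

  Center : Pred Carrier (a ⊔ ℓ)
  Center z = ∀ x → z ∙ x ≈ x ∙ z

  -- For a subgroup H this says x H = y H.
  SameLeftCoset : Pred Carrier p → Rel Carrier p
  SameLeftCoset H x y = x ⁻¹ ∙ y ∈ H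

  -- |G : H| = k, for a subgroup H. The coset space G/H is the carrier of G
  -- taken up to SameLeftCoset H, so a bijection from Fin k onto it amounts to
  -- a family of k elements containing exactly one representative of each
  -- left coset.
  HasIndex : Pred Carrier p → ℕ → Set (a ⊔ p)
  HasIndex H k =
    Σ[ t ∈ (Fin k → Carrier) ] Bijective _≡_ (SameLeftCoset H) t

  LeftTranslate : Carrier → Pred Carrier p → Pred Carrier (a ⊔ ℓ ⊔ p)
  LeftTranslate b X y = ∃[ x ] (x ∈ X × y ≈ b ∙ x)

  -- The translating elements need not be distinct.
  Large : ℕ → Pred Carrier p → Set (a ⊔ ℓ ⊔ p)
  Large k X = (b : Fin k → Carrier) →
    Satisfiable (⋂ (Fin k) (λ i → LeftTranslate (b i) X))

-- If r ∈ C_G(h) and r, a r both lie in {x : [x, g, h] = c}, then r [a r, g] = [a, g] r [r, g]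
-- together with the C_G(h)-invariance of y ↦ [y, h] under left multiplication gives
-- [a, g] ∈ C_G(h). Such an r comes from a common point w of the 2k translates by t₁, …, t_k and
-- t₁ a⁻¹, …, t_k a⁻¹, where the tᵢ represent the left cosets of C_G(h): take r = tⱼ⁻¹ w, where
-- w ∈ tⱼ C_G(h). The second claim reduces to the first because [g, x] = [x, g]⁻¹ and, for
-- central c, [y, h] = c implies [y⁻¹, h] = c⁻¹.
{-# OPTIONS --safe #-}
module Submission where

open import Defs
open import Algebra.Bundles using (Group)
import Algebra.Properties.Group as GroupProperties
open import Data.Fin.Base using (Fin; zero; suc; combine; remQuot)
open import Data.Fin.Properties using (remQuot-combine)
open import Data.Nat.Base using (ℕ; _*_)
open import Data.Product.Base using (_×_; _,_; proj₁; proj₂; ∃-syntax)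
open import Level using (Level)
open import Relation.Binary.Definitions using (_Respects_)
import Relation.Binary.PropositionalEquality.Core as ≡
open import Relation.Unary using (Pred; _∈_; _⊆_)
import Relation.Binary.Reasoning.Setoid as SetoidReasoning

module LargeCommutators {ℓ₁ ℓ₂ : Level} (G : Group ℓ₁ ℓ₂) where

  open Group G
  open GroupNotions G
  open GroupProperties G
  open SetoidReasoning setoid

  -- This equation determines the commutator by cancellation, so the later identities are derived
  -- from it without expanding inverses.
  commutator-swap : ∀ x y → y ∙ x ∙ [ x , y ] ≈ x ∙ y
  commutator-swap x y = begin
    y ∙ x ∙ (x ⁻¹ ∙ y ⁻¹ ∙ x ∙ y)     ≈⟨ ∙-congˡ (assoc _ x y) ⟩
    y ∙ x ∙ (x ⁻¹ ∙ y ⁻¹ ∙ (x ∙ y))   ≈⟨ ∙-congˡ (∙-congʳ (⁻¹-anti-homo-∙ y x)) ⟨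
    y ∙ x ∙ ((y ∙ x) ⁻¹ ∙ (x ∙ y))    ≈⟨ \\-leftDividesˡ (y ∙ x) (x ∙ y) ⟩
    x ∙ y                             ∎

  commutator-unique : ∀ {x y z} → y ∙ x ∙ z ≈ x ∙ y → [ x , y ] ≈ z
  commutator-unique {x} {y} e =
    ∙-cancelˡ (y ∙ x) _ _ (trans (commutator-swap x y) (sym e))

  swap-with-commutator : ∀ {x y c} → [ x , y ] ≈ c → y ∙ x ∙ c ≈ x ∙ y
  swap-with-commutator {x} {y} e = trans (∙-congˡ (sym e)) (commutator-swap x y)

  commutator-congˡ : ∀ {x y h} → x ≈ y → [ x , h ] ≈ [ y , h ]
  commutator-congˡ e = ∙-congʳ (∙-cong (∙-congʳ (⁻¹-cong e)) e)

  centralizer⇒commutator≈ε : ∀ {x h} → x ∈ Centralizer h → [ x , h ] ≈ ε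
  centralizer⇒commutator≈ε xh = commutator-unique (trans (identityʳ _) (sym xh))

  commutator-⁻¹ : ∀ x y → [ x , y ] ⁻¹ ≈ [ y , x ]
  commutator-⁻¹ x y = sym (commutator-unique (begin
    x ∙ y ∙ [ x , y ] ⁻¹                ≈⟨ ∙-congʳ (commutator-swap x y) ⟨
    y ∙ x ∙ [ x , y ] ∙ [ x , y ] ⁻¹    ≈⟨ //-rightDividesʳ [ x , y ] (y ∙ x) ⟩
    y ∙ x                               ∎))

  -- After left multiplication by `g ∙ a` both sides become `a ∙ r ∙ g`. This is the usual product
  -- rule for `[ a ∙ r , g ]`, multiplied by `r` so that no conjugate appears.
  commutator-product : ∀ a r g → [ a , g ] ∙ (r ∙ [ r , g ]) ≈ r ∙ [ a ∙ r , g ]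
  commutator-product a r g = ∙-cancelˡ (g ∙ a) _ _ (begin
    g ∙ a ∙ ([ a , g ] ∙ (r ∙ [ r , g ]))   ≈⟨ assoc _ _ _ ⟨
    g ∙ a ∙ [ a , g ] ∙ (r ∙ [ r , g ])     ≈⟨ ∙-congʳ (commutator-swap a g) ⟩
    a ∙ g ∙ (r ∙ [ r , g ])                 ≈⟨ assoc _ _ _ ⟩
    a ∙ (g ∙ (r ∙ [ r , g ]))               ≈⟨ ∙-congˡ (assoc _ _ _) ⟨
    a ∙ (g ∙ r ∙ [ r , g ])                 ≈⟨ ∙-congˡ (commutator-swap r g) ⟩
    a ∙ (r ∙ g)                             ≈⟨ assoc _ _ _ ⟨
    a ∙ r ∙ g                               ≈⟨ commutator-swap (a ∙ r) g ⟨
    g ∙ (a ∙ r) ∙ [ a ∙ r , g ]             ≈⟨ ∙-congʳ (assoc _ _ _) ⟨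
    g ∙ a ∙ r ∙ [ a ∙ r , g ]               ≈⟨ assoc _ _ _ ⟩
    g ∙ a ∙ (r ∙ [ a ∙ r , g ])             ∎)

  -- The factor `r` slides past `h`: the value `[ y , h ]` depends only on the conjugate of `h` by
  -- `y`, hence only on the right coset of the centralizer containing `y`.
  commutator-centralizer-∙ : ∀ {r h} → r ∈ Centralizer h → ∀ y → [ r ∙ y , h ] ≈ [ y , h ]
  commutator-centralizer-∙ {r} {h} rh y = commutator-unique (begin
    h ∙ (r ∙ y) ∙ [ y , h ]   ≈⟨ ∙-congʳ (assoc _ _ _) ⟨
    h ∙ r ∙ y ∙ [ y , h ]     ≈⟨ ∙-congʳ (∙-congʳ rh) ⟨
    r ∙ h ∙ y ∙ [ y , h ]     ≈⟨ ∙-congʳ (assoc _ _ _) ⟩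
    r ∙ (h ∙ y) ∙ [ y , h ]   ≈⟨ assoc _ _ _ ⟩
    r ∙ (h ∙ y ∙ [ y , h ])   ≈⟨ ∙-congˡ (commutator-swap y h) ⟩
    r ∙ (y ∙ h)               ≈⟨ assoc _ _ _ ⟨
    r ∙ y ∙ h                 ∎)

  -- Conversely, equal commutators with `h` force equal right cosets: multiplying by `v ∙ [ v , h ]`
  -- on the right turns both sides of the goal into `d ∙ v ∙ h`.
  commutator-∙≈⇒centralizer : ∀ {d v h} → [ d ∙ v , h ] ≈ [ v , h ] → d ∈ Centralizer h
  commutator-∙≈⇒centralizer {d} {v} {h} e =
    ∙-cancelʳ v _ _ (∙-cancelʳ [ v , h ] _ _ (begin
      d ∙ h ∙ v ∙ [ v , h ]     ≈⟨ ∙-congʳ (assoc _ _ _) ⟩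
      d ∙ (h ∙ v) ∙ [ v , h ]   ≈⟨ assoc _ _ _ ⟩
      d ∙ (h ∙ v ∙ [ v , h ])   ≈⟨ ∙-congˡ (commutator-swap v h) ⟩
      d ∙ (v ∙ h)               ≈⟨ assoc _ _ _ ⟨
      d ∙ v ∙ h                 ≈⟨ swap-with-commutator e ⟨
      h ∙ (d ∙ v) ∙ [ v , h ]   ≈⟨ ∙-congʳ (assoc _ _ _) ⟨
      h ∙ d ∙ v ∙ [ v , h ]     ∎))

  -- Clearing inverses leaves `y ∙ h ∙ y ⁻¹ ≈ h ∙ c`. Centrality lets `c` leave the gap between `y`
  -- and `y ⁻¹`, which then cancel.
  commutator-central-⁻¹ : ∀ {y h c} → c ∈ Center → [ y , h ] ≈ c → [ y ⁻¹ , h ] ≈ c ⁻¹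
  commutator-central-⁻¹ {y} {h} {c} cz e =
    commutator-unique (∙-cancelˡ y _ _ (∙-cancelʳ c _ _ (begin
      y ∙ (h ∙ y ⁻¹ ∙ c ⁻¹) ∙ c   ≈⟨ assoc _ _ _ ⟩
      y ∙ (h ∙ y ⁻¹ ∙ c ⁻¹ ∙ c)   ≈⟨ ∙-congˡ (//-rightDividesˡ c _) ⟩
      y ∙ (h ∙ y ⁻¹)              ≈⟨ assoc _ _ _ ⟨
      y ∙ h ∙ y ⁻¹                ≈⟨ ∙-congʳ (swap-with-commutator e) ⟨
      h ∙ y ∙ c ∙ y ⁻¹            ≈⟨ ∙-congʳ (cz (h ∙ y)) ⟨
      c ∙ (h ∙ y) ∙ y ⁻¹          ≈⟨ ∙-congʳ (assoc _ _ _) ⟨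
      c ∙ h ∙ y ∙ y ⁻¹            ≈⟨ //-rightDividesʳ y _ ⟩
      c ∙ h                       ≈⟨ cz h ⟩
      h ∙ c                       ≈⟨ ∙-congʳ (\\-leftDividesˡ y h) ⟨
      y ∙ (y ⁻¹ ∙ h) ∙ c          ∎)))

  Large-⊆ : ∀ {p q n} {X : Pred Carrier p} {Y : Pred Carrier q} → X ⊆ Y → Large n X → Large n Y
  Large-⊆ X⊆Y large b with large b
  ... | w , inAll = w , λ i → let x , x∈X , w≈bx = inAll i in x , X⊆Y x∈X , w≈bx

  LeftTranslate-member : ∀ {p} {X : Pred Carrier p} {b w} → X Respects _≈_ →
                         w ∈ LeftTranslate b X → b ⁻¹ ∙ w ∈ X
  LeftTranslate-member {b = b} {w} resp (x , x∈X , w≈bx) = resp (begin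
    x               ≈⟨ \\-leftDividesʳ b x ⟨
    b ⁻¹ ∙ (b ∙ x)  ≈⟨ ∙-congˡ w≈bx ⟨
    b ⁻¹ ∙ w        ∎) x∈X

  -- The coset of the common point is known only once that point is given, so two translates are
  -- prepared for each of the `k` representatives.
  Large⇒coset-pair : ∀ {p q k} {H : Pred Carrier q} {X : Pred Carrier p} → X Respects _≈_ →
                     HasIndex H k → Large (2 * k) X →
                     ∀ a → ∃[ r ] (r ∈ H × r ∈ X × a ∙ r ∈ X)
  Large⇒coset-pair {k = k} {X = X} resp (t , _ , surj) large a =
    t j ⁻¹ ∙ w , w∈tⱼH ≡.refl , inX zero , resp shift (inX (suc zero))
    where
    translator : Fin 2 × Fin k → Carrier
    translator (zero     , j) = t j
    -- The inverse of this translator is `a ∙ t j ⁻¹`, so it sends `w` to `a` times the chosen `r`.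
    translator (suc zero , j) = t j ∙ a ⁻¹

    common = large (λ i → translator (remQuot k i))
    w      = proj₁ common
    j      = proj₁ (surj w)
    w∈tⱼH  = proj₂ (surj w)

    inX : ∀ s → translator (s , j) ⁻¹ ∙ w ∈ X
    inX s = LeftTranslate-member resp
      (≡.subst (λ i → w ∈ LeftTranslate (translator i) X)
               (remQuot-combine s j) (proj₂ common (combine s j)))

    shift : (t j ∙ a ⁻¹) ⁻¹ ∙ w ≈ a ∙ (t j ⁻¹ ∙ w)
    shift = begin
      (t j ∙ a ⁻¹) ⁻¹ ∙ w     ≈⟨ ∙-congʳ (⁻¹-anti-homo-// (t j) a) ⟩
      a ∙ t j ⁻¹ ∙ w          ≈⟨ assoc a (t j ⁻¹) w ⟩
      a ∙ (t j ⁻¹ ∙ w)        ∎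

  Large⇒commutator∈centralizer : ∀ {g h c k} → HasIndex (Centralizer h) k →
                                 Large (2 * k) (λ x → [ [ x , g ] , h ] ≈ c) →
                                 ∀ a → [ a , g ] ∈ Centralizer h
  Large⇒commutator∈centralizer {g} {h} {c} index large a
    with Large⇒coset-pair
           (λ x≈y x∈X → trans (commutator-congˡ (commutator-congˡ (sym x≈y))) x∈X)
           index large a
  -- The cancelled factor `v` is `r ∙ [ r , g ]`; with or without `[ a , g ]` in front of it, the
  -- commutator with `h` is `c`.
  ... | r , r∈C , [r,g,h]≈c , [ar,g,h]≈c = commutator-∙≈⇒centralizer (begin
    [ [ a , g ] ∙ (r ∙ [ r , g ]) , h ]   ≈⟨ commutator-congˡ (commutator-product a r g) ⟩
    [ r ∙ [ a ∙ r , g ] , h ]             ≈⟨ commutator-centralizer-∙ r∈C _ ⟩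
    [ [ a ∙ r , g ] , h ]                 ≈⟨ [ar,g,h]≈c ⟩
    c                                     ≈⟨ [r,g,h]≈c ⟨
    [ [ r , g ] , h ]                     ≈⟨ commutator-centralizer-∙ r∈C _ ⟨
    [ r ∙ [ r , g ] , h ]                 ∎)

  triple-commutator-swap : ∀ {x y h c} → c ∈ Center →
                           [ [ x , y ] , h ] ≈ c → [ [ y , x ] , h ] ≈ c ⁻¹
  triple-commutator-swap {x} {y} c∈Z e =
    trans (commutator-congˡ (sym (commutator-⁻¹ x y))) (commutator-central-⁻¹ c∈Z e)

  ε∈Center : ε ∈ Center
  ε∈Center x = trans (identityˡ x) (sym (identityʳ x))

theorem5p11 : {ℓ₁ ℓ₂ : Level} (G : Group ℓ₁ ℓ₂) →
    let open Group G
        open GroupNotions G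
    in (g h c : Carrier) (k : ℕ) → HasIndex (Centralizer h) k →
       (Large (2 * k) (λ x → [ [ x , g ] , h ] ≈ c) →
         (a : Carrier) → [ [ a , g ] , h ] ≈ ε)
       ×
       (c ∈ Center → Large (2 * k) (λ x → [ [ g , x ] , h ] ≈ c) →
         (a : Carrier) → [ [ g , a ] , h ] ≈ ε)
theorem5p11 G g h c k index = first , second
  where
  open Group G
  open GroupNotions G
  open GroupProperties G using (ε⁻¹≈ε)
  open LargeCommutators G

  first : ∀ {c} → Large (2 * k) (λ x → [ [ x , g ] , h ] ≈ c) →
          ∀ a → [ [ a , g ] , h ] ≈ ε
  first large a = centralizer⇒commutator≈ε (Large⇒commutator∈centralizer index large a)

  second : c ∈ Center → Large (2 * k) (λ x → [ [ g , x ] , h ] ≈ c) →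
           ∀ a → [ [ g , a ] , h ] ≈ ε
  second c∈Z large a = trans
    -- Here `first` is applied with the constant `c ⁻¹`; its conclusion is then swapped back with
    -- the central value `ε`.
    (triple-commutator-swap ε∈Center (first (Large-⊆ (triple-commutator-swap c∈Z) large) a))
    ε⁻¹≈ε
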